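{- If $n > k \geq s \geq 0$ are integers, then there exists no $(n,k,s,s)$-oriented graph.
   Context: An oriented graph is a digraph with no loops and no pair of symmetric arcs. For vertices $u,v$ write $u(1\text{ - }0)v$ if there is an arc from $u$ to $v$, and $u(0\text{ - }0)v$ if there is no arc between $u$ and $v$. A vertex $v$ is weakly reachable within two steps from $u$ if $u(1\text{ - }0)v$, or $u(0\text{ - }0)v$, or for some vertex $w$ one has $u(1\text{ - }0)w(1\text{ - }0)v$, or $u(1\text{ - }0)w(0\text{ - }0)v$, or $u(0\text{ - }0)w(1\text{ - }0)v$. A vertex $u$ is a weak king if every other vertex is weakly reachable within two steps from $u$, and a weak serf if $u$ is weakly reachable within two steps from every other vertex. An $(n,k,s,b)$-oriented graph is an oriented graph on $n$ vertices with exactly $k$ weak kings and exactly $s$ weak serfs, such that exactly $b$ of the weak kings are also weak serfs. -}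

module Defs where

open import Data.Fin using (Fin; _≟_)
open import Data.Fin.Properties using (any?; all?)
open import Data.List using (length; filter; allFin)
open import Data.Nat using (ℕ)
open import Data.Product using (_×_; ∃-syntax)
open import Data.Sum using (_⊎_)
open import Level using (0ℓ)
open import Relation.Binary.Core using (Rel)
open import Relation.Binary.Definitions using (Decidable; Irreflexive; Asymmetric)
open import Relation.Binary.PropositionalEquality using (_≡_; _≢_)
open import Relation.Nullary using (¬_; ¬?; _×-dec_; _⊎-dec_; _→-dec_)
open import Relation.Unary using (Pred) renaming (Decidable to Decidable₁)
open import Relation.Unary.Properties using (_∩?_)

-- u ⟶ v is the paper's u(1-0)v.  Arcs are decidable because the graph is
-- finite, so that the kings and serfs can be counted.
record OrientedGraph (n : ℕ) : Set₁ where
  infix 4 _⟶_ _⟶?_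
  field
    _⟶_    : Rel (Fin n) 0ℓ
    _⟶?_   : Decidable _⟶_
    irrefl : Irreflexive _≡_ _⟶_
    asym   : Asymmetric _⟶_

cardinality : ∀ {n} {P : Pred (Fin n) 0ℓ} → Decidable₁ P → ℕ
cardinality {n} P? = length (filter P? (allFin n))

module _ {n : ℕ} (G : OrientedGraph n) where
  open OrientedGraph G

  -- u(0-0)v
  NoArc : Rel (Fin n) 0ℓ
  NoArc u v = ¬ (u ⟶ v) × ¬ (v ⟶ u)

  noArc? : Decidable NoArc
  noArc? u v = ¬? (u ⟶? v) ×-dec ¬? (v ⟶? u)

  -- WeaklyReachable u v: v is weakly reachable within two steps from u.
  WeaklyReachable : Rel (Fin n) 0ℓ
  WeaklyReachable u v =
    u ⟶ v ⊎
    NoArc u v ⊎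
    (∃[ w ] ((u ⟶ w × w ⟶ v) ⊎ (u ⟶ w × NoArc w v) ⊎ (NoArc u w × w ⟶ v)))

  weaklyReachable? : Decidable WeaklyReachable
  weaklyReachable? u v =
    (u ⟶? v) ⊎-dec
    noArc? u v ⊎-dec
    any? (λ w → ((u ⟶? w) ×-dec (w ⟶? v)) ⊎-dec
                ((u ⟶? w) ×-dec noArc? w v) ⊎-dec
                (noArc? u w ×-dec (w ⟶? v)))

  WeakKing : Pred (Fin n) 0ℓ
  WeakKing u = ∀ v → v ≢ u → WeaklyReachable u v

  weakKing? : Decidable₁ WeakKing
  weakKing? u = all? (λ v → ¬? (v ≟ u) →-dec weaklyReachable? u v)

  WeakSerf : Pred (Fin n) 0ℓ
  WeakSerf u = ∀ v → v ≢ u → WeaklyReachable v u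

  weakSerf? : Decidable₁ WeakSerf
  weakSerf? u = all? (λ v → ¬? (v ≟ u) →-dec weaklyReachable? v u)

-- An (n,k,s,b)-oriented graph.
record KingSerfGraph (n k s b : ℕ) : Set₁ where
  field
    graph     : OrientedGraph n
    kings     : cardinality (weakKing? graph) ≡ k
    serfs     : cardinality (weakSerf? graph) ≡ s
    kingSerfs : cardinality (weakKing? graph ∩? weakSerf? graph) ≡ b

{-# OPTIONS --safe #-}

-- If v does not weakly reach u within two steps, then u ⟶ v and u ⟶ w for all
-- v ⟶ w: as one says of tournaments, u covers v.  Covering is a strict partial
-- order.  Since b = s, every weak serf is a weak king.  By induction along
-- covering, suppose every vertex covered by u is a weak king.  Those vertices
-- then weakly reach u, and so does every vertex that u does not cover; so u is
-- a weak serf, hence a weak king.  Thus all n vertices are weak kings: n = k.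

module Submission where

open import Defs
open import Data.Fin using (Fin)
open import Data.Fin.Induction using (spo-noetherian)
open import Data.List using (List; length; filter; allFin)
open import Data.List.Membership.Propositional using (_∈_)
open import Data.List.Membership.Propositional.Properties using (∈-allFin; ∈-filter⁺; ∈-filter⁻)
open import Data.List.Properties using (filter-all; length-tabulate)
open import Data.List.Relation.Binary.Pointwise using (Pointwise-≡⇒≡)
open import Data.List.Relation.Binary.Sublist.Propositional using (⊆-refl)
open import Data.List.Relation.Binary.Sublist.Propositional.Properties using (filter⁺; to-≋)
open import Data.List.Relation.Unary.All.Properties using (tabulate⁺)
open import Data.Nat using (ℕ; _>_; _≥_)
open import Data.Nat.Properties using (<⇒≢)
open import Data.Product using (_×_; _,_; proj₁; proj₂)
open import Data.Sum using (inj₁; inj₂)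
open import Function using (_∘_; flip; id)
open import Induction.WellFounded using (WellFounded; module All)
open import Level using (Level; _⊔_; 0ℓ)
open import Relation.Binary.Core using (Rel)
open import Relation.Binary.Definitions using (Irreflexive)
open import Relation.Binary.PropositionalEquality
  using (_≡_; refl; sym; trans; cong; subst; isEquivalence; resp₂; module ≡-Reasoning)
open import Relation.Binary.Structures using (IsStrictPartialOrder)
open import Relation.Nullary using (¬_; decidable-stable)
open import Relation.Unary using (Pred; Universal; _⊆_) renaming (Decidable to Decidable₁)
open import Relation.Unary.Properties using (_∩?_)

private
  variable
    a p q ℓ : Level
    A : Set a
    n : ℕ

filter-⊆-length-≡⇒≡ : {P : Pred A p} {Q : Pred A q} (P? : Decidable₁ P) (Q? : Decidable₁ Q) →
                      P ⊆ Q → (xs : List A) →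
                      length (filter P? xs) ≡ length (filter Q? xs) →
                      filter P? xs ≡ filter Q? xs
filter-⊆-length-≡⇒≡ P? Q? P⊆Q xs lengths-≡ =
  Pointwise-≡⇒≡ (to-≋ lengths-≡ (filter⁺ P? Q? (λ { refl → P⊆Q }) (⊆-refl {x = xs})))

cardinality-universal : {P : Pred (Fin n) 0ℓ} (P? : Decidable₁ P) →
                        Universal P → cardinality P? ≡ n
cardinality-universal {n} P? all-P = begin
  length (filter P? (allFin n)) ≡⟨ cong length (filter-all P? (tabulate⁺ all-P)) ⟩
  length (allFin n)             ≡⟨ length-tabulate id ⟩
  n                             ∎
  where open ≡-Reasoning

cardinality-⊆-≡⇒⊇ : {P Q : Pred (Fin n) 0ℓ} (P? : Decidable₁ P) (Q? : Decidable₁ Q) →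
                    P ⊆ Q → cardinality P? ≡ cardinality Q? → Q ⊆ P
cardinality-⊆-≡⇒⊇ {n} P? Q? P⊆Q cardinalities-≡ {x} Qx =
  proj₂ (∈-filter⁻ P? {xs = allFin n} x∈filter-P)
  where
  x∈filter-P : x ∈ filter P? (allFin n)
  x∈filter-P = subst (x ∈_) (sym (filter-⊆-length-≡⇒≡ P? Q? P⊆Q (allFin n) cardinalities-≡))
                 (∈-filter⁺ Q? (∈-allFin x) Qx)

Covers : {A : Set a} → Rel A ℓ → Rel A (a ⊔ ℓ)
Covers _⟶_ u v = u ⟶ v × (v ⟶_) ⊆ (u ⟶_)

covers-isStrictPartialOrder : {_⟶_ : Rel A ℓ} → Irreflexive _≡_ _⟶_ →
                              IsStrictPartialOrder _≡_ (Covers _⟶_)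
covers-isStrictPartialOrder {_⟶_ = _⟶_} irrefl = record
  { isEquivalence = isEquivalence
  ; irrefl        = λ u≡v (u⟶v , _) → irrefl u≡v u⟶v
  ; trans         = λ (_ , v⊆u) (v⟶w , w⊆v) → v⊆u v⟶w , v⊆u ∘ w⊆v
  ; <-resp-≈      = resp₂ (Covers _⟶_)
  }

module _ (G : OrientedGraph n) where
  open OrientedGraph G

  coveredBy-wellFounded : WellFounded (flip (Covers _⟶_))
  coveredBy-wellFounded = spo-noetherian (covers-isStrictPartialOrder irrefl)

  ¬weaklyReachable⇒covers : ∀ {u v} → ¬ WeaklyReachable G v u → Covers _⟶_ u v
  ¬weaklyReachable⇒covers {u} {v} v↛↛u = u⟶v , u⟶w
    where
    u⟶v : u ⟶ v
    u⟶v = decidable-stable (u ⟶? v) λ u↛v →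
      v↛↛u (inj₂ (inj₁ (v↛↛u ∘ inj₁ , u↛v)))

    u⟶w : ∀ {w} → v ⟶ w → u ⟶ w
    u⟶w {w} v⟶w = decidable-stable (u ⟶? w) λ u↛w →
      v↛↛u (inj₂ (inj₂ (w , inj₂ (inj₁ (v⟶w , w↛u , u↛w)))))
      where
      w↛u : ¬ (w ⟶ u)
      w↛u w⟶u = v↛↛u (inj₂ (inj₂ (w , inj₁ (v⟶w , w⟶u))))

  coveredKings⇒weakSerf : ∀ {u} → Covers _⟶_ u ⊆ WeakKing G → WeakSerf G u
  coveredKings⇒weakSerf {u} covered-kings v v≢u =
    decidable-stable (weaklyReachable? G v u) λ v↛↛u →
      v↛↛u (covered-kings (¬weaklyReachable⇒covers v↛↛u) u (v≢u ∘ sym))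

  serfs⊆kings⇒allKings : WeakSerf G ⊆ WeakKing G → Universal (WeakKing G)
  serfs⊆kings⇒allKings serfs⊆kings = wfRec (WeakKing G) λ _ covered-kings →
    serfs⊆kings (coveredKings⇒weakSerf covered-kings)
    where open All coveredBy-wellFounded 0ℓ using (wfRec)

theorem8 : ∀ (n k s : ℕ) → n > k → k ≥ s → s ≥ 0 → ¬ KingSerfGraph n k s s
theorem8 n k s n>k _ _ G =
  <⇒≢ n>k (trans (sym kings) (cardinality-universal (weakKing? graph) all-kings))
  where
  open KingSerfGraph G

  serfs⊆kings : WeakSerf graph ⊆ WeakKing graph
  serfs⊆kings = proj₁ ∘ cardinality-⊆-≡⇒⊇ (weakKing? graph ∩? weakSerf? graph) (weakSerf? graph)
                          proj₂ (trans kingSerfs (sym serfs))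

  all-kings : Universal (WeakKing graph)
  all-kings = serfs⊆kings⇒allKings graph serfs⊆kings
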